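{- Let $G$ be a graph without loops. The R-cocore of $G$ is unique up to isomorphism; that is, any two R-cocores of $G$ are isomorphic graphs.
   Context: Graphs are finite and undirected: $G=(V_G,E_G)$ with $E_G\subseteq V_G\times V_G$ symmetric. For a graph $G$, a finite set $B$ and a relation $R\subseteq V_G\times B$ with full image (for every $b\in B$ there is $v\in V_G$ with $(v,b)\in R$), $G\ast R$ is the graph with vertex set $B$ and edge set $\{(u,v)\in B\times B : \text{there is } (x,y)\in E_G \text{ with } (x,u),(y,v)\in R\}$. The equation $H\ast R=G$ means that $R\subseteq V_H\times V_G$ has full image and $H\ast R$ equals $G$ as a graph. Let $H$ be an induced subgraph of $G$. An R-coretraction of $H$ to $G$ is a relation $R\subseteq V_H\times V_G$ such that $H\ast R=G$ and $(x,x)\in R$ for all $x\in V_H$; if one exists, $H$ is called an R-coretract of $G$. An R-coretract $H$ of $G$ is an R-cocore of $G$ if $H$ has no proper induced subgraph that is an R-coretract of $H$. -}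

module Defs where

open import Data.Bool using (Bool; true; false; T)
open import Data.Bool.Properties using (T-irrelevant)
open import Data.Fin using (Fin; zero; suc)
import Data.Fin.Properties as Fin
open import Data.Nat using (ℕ)
open import Data.Product using (Σ; ∃; ∃-syntax; _×_; _,_; proj₁; proj₂)
open import Function using (_∘_; _on_)
open import Function.Bundles using (_↔_; _⇔_; Inverse; mk↔ₛ′)
open import Level using (0ℓ)
open import Relation.Binary using (Rel; REL; Symmetric; Decidable)
open import Relation.Binary.PropositionalEquality using (_≡_; refl; sym; trans; cong; subst)
open import Relation.Nullary using (¬_; Dec)
open import Relation.Nullary.Decidable using (map′; _×-dec_)
import Relation.Unary as Unary

record FinSet : Set₁ where
  field
    Carrier     : Set
    size        : ℕ
    enumeration : Carrier ↔ Fin size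

∣_∣ : FinSet → Set
∣ V ∣ = FinSet.Carrier V

-- Membership is Bool-valued so that membership proofs are unique, and a
-- subset viewed as a set contains each of its elements exactly once.

Subset : FinSet → Set
Subset V = ∣ V ∣ → Bool

Proper : ∀ V → Subset V → Set
Proper V S = ∃[ v ] ¬ T (S v)

any? : ∀ V {P : Unary.Pred ∣ V ∣ 0ℓ} → Unary.Decidable P → Dec (∃ P)
any? V {P} P? =
  map′ (λ (i , p) → from i , p)
       (λ (v , p) → to v , subst P (sym (strictlyInverseʳ v)) p)
       (Fin.any? (P? ∘ from))
  where open Inverse (FinSet.enumeration V)

private
  Σ-≡ : ∀ {A : Set} {S : A → Bool} {x y : Σ A (T ∘ S)} →
        proj₁ x ≡ proj₁ y → x ≡ y
  Σ-≡ {x = a , p} {y = .a , q} refl = cong (a ,_) (T-irrelevant p q)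

  enumerateFin : ∀ n (S : Fin n → Bool) → ∃[ m ] (Σ (Fin n) (T ∘ S) ↔ Fin m)
  enumerateFin ℕ.zero S = 0 , mk↔ₛ′ (λ ()) (λ ()) (λ ()) (λ ())
  enumerateFin (ℕ.suc n) S with enumerateFin n (S ∘ suc) | S zero in eq
  ... | m , e | true = ℕ.suc m , mk↔ₛ′ f g f∘g g∘f
    where
    open Inverse e
    f : Σ (Fin (ℕ.suc n)) (T ∘ S) → Fin (ℕ.suc m)
    f (zero  , p) = zero
    f (suc i , p) = suc (to (i , p))
    g : Fin (ℕ.suc m) → Σ (Fin (ℕ.suc n)) (T ∘ S)
    g zero    = zero , subst T (sym eq) _
    g (suc j) = suc (proj₁ (from j)) , proj₂ (from j)
    f∘g : ∀ j → f (g j) ≡ j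
    f∘g zero    = refl
    f∘g (suc j) = cong suc (strictlyInverseˡ j)
    g∘f : ∀ x → g (f x) ≡ x
    g∘f (zero  , p) = Σ-≡ refl
    g∘f (suc i , p) = Σ-≡ (cong (suc ∘ proj₁) (strictlyInverseʳ (i , p)))
  ... | m , e | false = m , mk↔ₛ′ f g f∘g g∘f
    where
    open Inverse e
    f : Σ (Fin (ℕ.suc n)) (T ∘ S) → Fin m
    f (zero  , p) with () ← subst T eq p
    f (suc i , p) = to (i , p)
    g : Fin m → Σ (Fin (ℕ.suc n)) (T ∘ S)
    g j = suc (proj₁ (from j)) , proj₂ (from j)
    f∘g : ∀ j → f (g j) ≡ j
    f∘g j = strictlyInverseˡ j
    g∘f : ∀ x → g (f x) ≡ x
    g∘f (zero  , p) with () ← subst T eq p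
    g∘f (suc i , p) = Σ-≡ (cong (suc ∘ proj₁) (strictlyInverseʳ (i , p)))

  enumerate : ∀ V (S : Subset V) → ∃[ m ] (Σ ∣ V ∣ (T ∘ S) ↔ Fin m)
  enumerate V S with enumerateFin (FinSet.size V) (S ∘ Inverse.from (FinSet.enumeration V))
  ... | m , e = m , mk↔ₛ′
      (λ (v , p) → E.to (V.to v , subst (T ∘ S) (sym (V.strictlyInverseʳ v)) p))
      (λ j → V.from (proj₁ (E.from j)) , proj₂ (E.from j))
      (λ j → trans (cong E.to (Σ-≡ (V.strictlyInverseˡ _))) (E.strictlyInverseˡ j))
      (λ (v , p) → Σ-≡ (trans (cong (V.from ∘ proj₁) (E.strictlyInverseʳ _))
                              (V.strictlyInverseʳ v)))
    where
    module V = Inverse (FinSet.enumeration V)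
    module E = Inverse e

_↾_ : (V : FinSet) → Subset V → FinSet
V ↾ S = record
  { Carrier     = Σ ∣ V ∣ (T ∘ S)
  ; size        = proj₁ (enumerate V S)
  ; enumeration = proj₂ (enumerate V S)
  }

-- Decidability (here and in Graph) is part of the data: classically it holds
-- for every subset of a product of finite sets.

record Relation (A B : FinSet) : Set₁ where
  field
    Holds  : REL ∣ A ∣ ∣ B ∣ 0ℓ
    holds? : Decidable Holds

open Relation public

FullImage : ∀ {A B} → Relation A B → Set
FullImage R = ∀ b → ∃[ a ] Holds R a b

record Graph (V : FinSet) : Set₁ where
  field
    Edge      : Rel ∣ V ∣ 0ℓ
    symmetric : Symmetric Edge
    edge?     : Decidable Edge

open Graph public

Loopless : ∀ {V} → Graph V → Set
Loopless G = ∀ v → ¬ Edge G v v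

-- Equality (not isomorphism) of graphs on one vertex set: equal edge sets.

infix 4 _≈_ _≅_

_≈_ : ∀ {V} → Graph V → Graph V → Set
G ≈ G′ = ∀ u v → Edge G u v ⇔ Edge G′ u v

record _≅_ {V W} (G : Graph V) (H : Graph W) : Set where
  field
    bijection : ∣ V ∣ ↔ ∣ W ∣
    edges     : ∀ u v → Edge G u v ⇔
                Edge H (Inverse.to bijection u) (Inverse.to bijection v)

infix 8 _[_]

_[_] : ∀ {V} → Graph V → (S : Subset V) → Graph (V ↾ S)
G [ S ] = record
  { Edge      = Edge G on proj₁
  ; symmetric = symmetric G
  ; edge?     = λ u v → edge? G (proj₁ u) (proj₁ v)
  }

infixl 7 _∗_

_∗_ : ∀ {V B} → Graph V → Relation V B → Graph B
_∗_ {V} G R = record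
  { Edge      = λ u v → ∃[ x ] ∃[ y ] (Edge G x y × Holds R x u × Holds R y v)
  ; symmetric = λ (x , y , xy , xu , yv) → y , x , symmetric G xy , yv , xu
  ; edge?     = λ u v → any? V λ x → any? V λ y →
                  edge? G x y ×-dec holds? R x u ×-dec holds? R y v
  }

-- An induced subgraph H of G is given by its vertex set S, as H = G [ S ].

record IsRCoretraction {V} (G : Graph V) (S : Subset V)
                       (R : Relation (V ↾ S) V) : Set where
  field
    fullImage : FullImage R
    equation  : G [ S ] ∗ R ≈ G
    reflexive : ∀ x → Holds R x (proj₁ x)

IsRCoretract : ∀ {V} → Graph V → Subset V → Set₁
IsRCoretract G S = ∃[ R ] IsRCoretraction G S R

record IsRCocore {V} (G : Graph V) (S : Subset V) : Set₁ where
  field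
    coretract : IsRCoretract G S
    minimal   : ¬ (∃[ K ] Proper (V ↾ S) K × IsRCoretract (G [ S ]) K)

{-# OPTIONS --safe #-}

-- Order vertices by inclusion of neighbourhoods. An R-coretract is exactly a
-- vertex set S such that every neighbourhood is the union of a nonempty family
-- of neighbourhoods of vertices of S. In an R-cocore no neighbourhood is such a
-- union of the others, so an R-cocore has exactly one vertex for each
-- union-irreducible neighbourhood. Vertices of two R-cocores with
-- the same neighbourhood therefore correspond bijectively, and this
-- correspondence preserves edges.

module Submission where

open import Data.Bool using (T)
open import Data.Bool.Properties using (T?; T-irrelevant)
import Data.Fin.Properties as Fin
open import Data.Product using (∃-syntax; _×_; _,_; proj₁; proj₂)
open import Function using (_∘_)
open import Function.Bundles using (Inverse; Equivalence; mk⇔; mk↔ₛ′)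
open import Function.Properties.Inverse using (↔⇒↣)
open import Level using (0ℓ)
open import Relation.Binary using (Decidable; DecidableEquality)
open import Relation.Binary.PropositionalEquality using (_≡_; _≢_; refl; sym; subst)
open import Relation.Nullary using (¬_; Dec; yes; no)
open import Relation.Nullary.Decidable
  using (map′; _×-dec_; _→-dec_; ⌊_⌋; decidable-stable; ¬?; toWitness; fromWitness; via-injection)
import Relation.Unary as Unary

open import Defs

all? : ∀ V {P : Unary.Pred ∣ V ∣ 0ℓ} → Unary.Decidable P → Dec (∀ v → P v)
all? V {P} P? =
  map′ (λ h v → subst P (strictlyInverseʳ v) (h (to v)))
       (λ h i → h (from i))
       (Fin.all? (P? ∘ from))
  where open Inverse (FinSet.enumeration V)

≟ : ∀ V → DecidableEquality ∣ V ∣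
≟ V = via-injection (↔⇒↣ (FinSet.enumeration V)) Fin._≟_

↾-≡ : ∀ V {S : Subset V} {x y : ∣ V ↾ S ∣} → proj₁ x ≡ proj₁ y → x ≡ y
↾-≡ V {x = v , p} {y = .v , q} refl with refl ← T-irrelevant p q = refl

module _ {V} (G : Graph V) where

  infix 4 _⊑_

  _⊑_ : ∣ V ∣ → ∣ V ∣ → Set
  v ⊑ w = ∀ u → Edge G v u → Edge G w u

  ⊑-refl : ∀ {v} → v ⊑ v
  ⊑-refl u e = e

  ⊑-trans : ∀ {u v w} → u ⊑ v → v ⊑ w → u ⊑ w
  ⊑-trans u⊑v v⊑w t = v⊑w t ∘ u⊑v t

  ⊑? : Decidable _⊑_
  ⊑? v w = all? V λ u → edge? G v u →-dec edge? G w u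

  -- Nonemptiness is a separate requirement because an isolated vertex has the
  -- empty union as its neighbourhood.
  record IsUnion (P : Unary.Pred ∣ V ∣ 0ℓ) (v : ∣ V ∣) : Set where
    field
      nonempty : ∃[ x ] P x × x ⊑ v
      covered  : ∀ u → Edge G v u → ∃[ x ] P x × x ⊑ v × Edge G x u

  open IsUnion public

  member⇒isUnion : ∀ {P v} → P v → IsUnion P v
  member⇒isUnion {v = v} p = record
    { nonempty = v , p , ⊑-refl
    ; covered  = λ u e → v , p , ⊑-refl , e
    }

  ⊑⊒⇒isUnion : ∀ {P v w} → P w → w ⊑ v → v ⊑ w → IsUnion P v
  ⊑⊒⇒isUnion {w = w} p w⊑v v⊑w = record
    { nonempty = w , p , w⊑v
    ; covered  = λ u e → w , p , w⊑v , v⊑w u e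
    }

  isUnion-trans : ∀ {P Q v} → IsUnion P v →
                  (∀ w → P w → w ⊑ v → IsUnion Q w) → IsUnion Q v
  isUnion-trans P∋v Q∋ = record
    { nonempty = let w , p , w⊑v = nonempty P∋v
                     x , q , x⊑w = nonempty (Q∋ w p w⊑v)
                 in x , q , ⊑-trans x⊑w w⊑v
    ; covered  = λ u e →
        let w , p , w⊑v , wu = covered P∋v u e
            x , q , x⊑w , xu = covered (Q∋ w p w⊑v) u wu
        in x , q , ⊑-trans x⊑w w⊑v , xu
    }

  isUnion-map : ∀ {P Q v} → (∀ x → P x → x ⊑ v → Q x) → IsUnion P v → IsUnion Q v
  isUnion-map f P∋v = isUnion-trans P∋v λ w p w⊑v → member⇒isUnion (f w p w⊑v)

  Generates : Subset V → Set
  Generates S = ∀ v → IsUnion (T ∘ S) v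

  -- By `holds⇒⊑`, vertices related to `v` have neighbourhoods inside that of `v`; they form the
  -- required family.
  coretract⇒generates : ∀ {S} → IsRCoretract G S → Generates S
  coretract⇒generates {S} (R , isR) v = record
    { nonempty = let (x , x∈S) , xRv = fullImage v in x , x∈S , holds⇒⊑ xRv
    ; covered  = λ u vu →
        let (x , x∈S) , y , xy , xRv , yRu = Equivalence.from (equation v u) vu
        in x , x∈S , holds⇒⊑ xRv ,
           symmetric G (transport {y} {x , x∈S} yRu (symmetric G xy))
    }
    where
    open IsRCoretraction isR

    transport : ∀ {x y : ∣ V ↾ S ∣} {w} →
                Holds R x w → Edge G (proj₁ x) (proj₁ y) → Edge G w (proj₁ y)
    transport {x} {y} {w} xRw xy =
      Equivalence.to (equation w (proj₁ y)) (x , y , xy , xRw , reflexive y)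

    -- Since `u` may lie outside `S`, `equation` first lifts the edge from `x` to `u` to an edge
    -- from `a` to `b` inside `S`. Reflexivity of `R`, used in `transport`, moves `a` back to `x`,
    -- and the edge from `x` to `b` then maps to one from `w` to `u`.
    holds⇒⊑ : ∀ {x : ∣ V ↾ S ∣} {w} → Holds R x w → proj₁ x ⊑ w
    holds⇒⊑ {x} {w} xRw u xu =
      let a , b , ab , aRx , bRu = Equivalence.from (equation (proj₁ x) u) xu
      in Equivalence.to (equation w u)
           (x , b , transport {a} {b} aRx ab , xRw , bRu)

  -- The witness is the largest candidate: `holds⇒⊑` puts every R-coretraction inside it.
  generates⇒coretract : ∀ {S} → Generates S → IsRCoretract G S
  generates⇒coretract {S} gen = R , record
    { fullImage = λ v → let x , x∈S , x⊑v = nonempty (gen v) in (x , x∈S) , x⊑v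
    ; equation  = λ u v → mk⇔
        (λ (x , y , xy , x⊑u , y⊑v) →
          x⊑u v (symmetric G (y⊑v (proj₁ x) (symmetric G xy))))
        (λ uv →
          let x , x∈S , x⊑u , xv = covered (gen u) v uv
              -- Covering the neighbour `x` of `v`, rather than `u`, yields an edge with both ends
              -- in `S`.
              y , y∈S , y⊑v , yx = covered (gen v) x (symmetric G xv)
          in (x , x∈S) , (y , y∈S) , symmetric G yx , x⊑u , y⊑v)
    ; reflexive = λ _ → ⊑-refl
    }
    where
    R : Relation (V ↾ S) V
    R = record
      { Holds  = λ x v → proj₁ x ⊑ v
      ; holds? = λ x v → ⊑? (proj₁ x) v
      }

module _ {V} (G : Graph V) where

  -- Needed because minimality concerns coretracts of `G [ S ]`, not of `G`.
  isUnion-restrict : ∀ {S : Subset V} {P v} → IsUnion G (λ y → T (S y) × P y) (proj₁ v) →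
                     IsUnion (G [ S ]) (P ∘ proj₁) v
  isUnion-restrict union = record
    { nonempty = let y , (y∈S , p) , y⊑v = nonempty union
                 in (y , y∈S) , p , y⊑v ∘ proj₁
    ; covered  = λ u vu →
        let y , (y∈S , p) , y⊑v , yu = covered union (proj₁ u) vu
        in (y , y∈S) , p , y⊑v ∘ proj₁ , yu
    }

  -- Otherwise `S` without `x` would still generate `G [ S ]`, giving a proper R-coretract.
  cocore-irredundant : ∀ {S} → IsRCocore G S → ∀ {x} → T (S x) →
                       ¬ IsUnion G (λ y → T (S y) × y ≢ x) x
  cocore-irredundant {S} cocore {x} x∈S union =
    IsRCocore.minimal cocore
      ( others
      , ((x , x∈S) , λ t → toWitness t refl)
      , generates⇒coretract (G [ S ]) generates
      )
    where
    others : Subset (V ↾ S)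
    others y = ⌊ ¬? (≟ V (proj₁ y) x) ⌋

    generates : Generates (G [ S ]) others
    generates y with ≟ V (proj₁ y) x
    ... | yes refl = isUnion-map (G [ S ]) (λ _ y≢x _ → fromWitness y≢x)
                       (isUnion-restrict union)
    ... | no y≢x   = member⇒isUnion (G [ S ]) (fromWitness y≢x)

  -- If `x` and `y` were distinct, `y` alone would be a one-member union for `x`.
  cocore-injective : ∀ {S} → IsRCocore G S → ∀ {x y} → T (S x) → T (S y) →
                     _⊑_ G x y → _⊑_ G y x → x ≡ y
  cocore-injective cocore {x} {y} x∈S y∈S x⊑y y⊑x =
    decidable-stable (≟ V x y) λ x≢y →
      cocore-irredundant cocore x∈S
        (⊑⊒⇒isUnion G (y∈S , x≢y ∘ sym) y⊑x x⊑y)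

  -- If no such x′ exists, writing x as a union over S′ and each member of that
  -- union as a union over S never uses x itself.
  cocore-twin : ∀ {S S′} → IsRCocore G S → Generates G S′ → ∀ {x} → T (S x) →
                ∃[ x′ ] T (S′ x′) × _⊑_ G x x′ × _⊑_ G x′ x
  cocore-twin {S} {S′} cocore gen′ {x} x∈S =
    decidable-stable (any? V λ x′ → T? (S′ x′) ×-dec ⊑? G x x′ ×-dec ⊑? G x′ x)
      λ noTwin → cocore-irredundant cocore x∈S
        (isUnion-trans G (gen′ x) λ x′ x′∈S′ x′⊑x →
          isUnion-map G
            -- If `y` were `x`, then `x ⊑ x′ ⊑ x` would make `x′` the excluded twin.
            (λ y y∈S y⊑x′ → y∈S , λ { refl → noTwin (x′ , x′∈S′ , y⊑x′ , x′⊑x) })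
            (gen x′))
    where
    gen : Generates G S
    gen = coretract⇒generates G (IsRCocore.coretract cocore)

  twins-edge : ∀ {u u′ v v′} → _⊑_ G u u′ → _⊑_ G v v′ → Edge G u v → Edge G u′ v′
  twins-edge {u′ = u′} {v = v} u⊑u′ v⊑v′ uv =
    symmetric G (v⊑v′ u′ (symmetric G (u⊑u′ v uv)))

proposition5p16 : ∀ {V : FinSet} (G : Graph V) → Loopless G →
    ∀ (S S′ : Subset V) → IsRCocore G S → IsRCocore G S′ → G [ S ] ≅ G [ S′ ]
proposition5p16 {V} G _ S S′ cocore cocore′ = record
  { bijection = mk↔ₛ′ (to cocore cocore′) (to cocore′ cocore)
                  (inverse cocore′ cocore) (inverse cocore cocore′)
  ; edges     = λ (u , u∈S) (v , v∈S) →
      let _ , _ , u⊑u′ , u′⊑u = twin cocore cocore′ u∈S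
          _ , _ , v⊑v′ , v′⊑v = twin cocore cocore′ v∈S
      in mk⇔ (twins-edge G u⊑u′ v⊑v′) (twins-edge G u′⊑u v′⊑v)
  }
  where
  twin : ∀ {A B} → IsRCocore G A → IsRCocore G B → ∀ {x} → T (A x) →
         ∃[ y ] T (B y) × _⊑_ G x y × _⊑_ G y x
  twin a b = cocore-twin G a (coretract⇒generates G (IsRCocore.coretract b))

  to : ∀ {A B} → IsRCocore G A → IsRCocore G B → ∣ V ↾ A ∣ → ∣ V ↾ B ∣
  to a b (x , x∈A) = let y , y∈B , _ = twin a b x∈A in y , y∈B

  inverse : ∀ {A B} (a : IsRCocore G A) (b : IsRCocore G B) →
            ∀ x → to b a (to a b x) ≡ x
  inverse a b (x , x∈A) =
    let y , y∈B , x⊑y , y⊑x = twin a b x∈A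
        z , z∈A , y⊑z , z⊑y = twin b a y∈B
    -- Both `z` and `x` lie in `A` and share the neighbourhood of `y`.
    in ↾-≡ V (cocore-injective G a z∈A x∈A
                (⊑-trans G z⊑y y⊑x) (⊑-trans G x⊑y y⊑z))
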